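{- Let $k\ge 2$ and $r$ be integers with $1\le r\le k$, and let $S(r,k)=\sum_{n=1}^{k}|\mathcal{P}_n(r,k)|$. Then $$S(r,k)=\frac{1}{k}\sum_{s\mid (k,r)}\binom{k/s}{r/s}\varphi(s),$$ where the sum is taken over all positive divisors $s$ of the greatest common divisor $(k,r)$ of $k$ and $r$.
   Context: For a finite set $A$ of nonnegative integers and a positive integer $i$, let $\overline{A}(i)\subseteq\{0,1,\ldots,i-1\}$ be the set of residues modulo $i$ of the elements of $A$; two finite sets $A,B$ are called equal modulo $i$ if $\overline{A}(i)=\overline{B}(i)$. Write $A+t=\{a+t: a\in A\}$. For integers $1\le j\le i$, $\mathcal{A}(j,i)$ denotes the collection of all subsets of $\{0,1,\ldots,i-1\}$ with exactly $j$ elements. For $A\in\mathcal{A}(j,i)$, $f_i(A)$ denotes the smallest positive integer $l$ such that $A$ equals $A+l$ modulo $i$ (it exists and is at most $i$). For $1\le s\le i$, $\mathcal{A}_s(j,i)=\{A\in\mathcal{A}(j,i): f_i(A)=s\}$. For $1\le n\le k$, two sets $A,A'\in\mathcal{A}_n(r,k)$ are called $k$-equivalent if there exists $j\in\{0,1,\ldots,k-1\}$ such that $A+j$ equals $A'$ modulo $k$; this is an equivalence relation, and $\mathcal{P}_n(r,k)$ denotes the set of its equivalence classes in $\mathcal{A}_n(r,k)$ (empty if $\mathcal{A}_n(r,k)$ is empty). $(x,y)$ denotes the greatest common divisor, $|\cdot|$ cardinality, and $\varphi$ the Euler totient function. -}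

module Defs where

open import Data.Bool.Properties using () renaming (_≟_ to _≟ᵇ_)
open import Data.Fin.Base using (Fin; zero; suc; toℕ; fromℕ<)
open import Data.Fin.Properties using (any?; toℕ<n; toℕ-fromℕ<; fromℕ<-cong)
open import Data.Fin.Subset using (Subset; inside; outside; ⁅_⁆; ⋃; ∣_∣; _∈_; _⊆_)
open import Data.Fin.Subset.Properties using (_∈?_; x∈⁅x⁆; x∈⁅y⁆⇒x≡y; x∈p∪q⁺; x∈p∪q⁻; ⊆-antisym; ∉⊥)
open import Data.List.Base using (List; []; _∷_; _++_; map; filter; length; upTo; allFin; deduplicate; lookup)
open import Data.List.Membership.Propositional using () renaming (_∈_ to _∈ˡ_)
open import Data.List.Membership.Propositional.Properties using (∈-map⁺; ∈-map⁻; ∈-filter⁺; ∈-lookup; ∈-++⁺ˡ; ∈-++⁺ʳ)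
open import Data.List.Properties using (map-∘; map-cong)
open import Data.List.Relation.Unary.All using (All; []; _∷_)
import Data.List.Relation.Unary.All as All
import Data.List.Relation.Unary.All.Properties as Allₚ
open import Data.List.Relation.Unary.AllPairs using (AllPairs; []; _∷_)
open import Data.List.Relation.Unary.Any using (Any; here; there)
import Data.List.Relation.Unary.Any as Any
import Data.List.Relation.Unary.Any.Properties as Anyₚ
open import Data.List.Relation.Unary.Unique.DecSetoid.Properties using (deduplicate-!)
open import Data.Nat.Base using (ℕ; zero; suc; _+_; _∸_; _≤_; _%_; NonZero; z≤n; s≤s; >-nonZero⁻¹)
open import Data.Nat.Coprimality using (coprime?)
open import Data.Nat.Divisibility using (_∣?_)
open import Data.Nat.DivMod using (_mod_; m%n<n; [m+n]%n≡m%n; %-distribˡ-+; m%n%n≡m%n)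
open import Data.Nat.ListAction using (sum)
open import Data.Nat.Properties using (_≟_; _≤?_; +-assoc; +-identityʳ; m+[n∸m]≡n; <⇒≤)
open import Data.Product.Base using (_×_; _,_; ∃; ∃-syntax; proj₁; proj₂)
open import Data.Sum.Base using (inj₁; inj₂)
import Data.Vec.Base as Vec
open import Data.Vec.Properties using (≡-dec)
open import Function.Base using (_∘_; _on_)
open import Function.Bundles using (Bijection)
open import Level using (0ℓ)
open import Relation.Binary.Bundles using (Setoid; DecSetoid)
open import Relation.Binary.Core using (Rel)
import Relation.Binary.Definitions as B
open import Relation.Binary.PropositionalEquality using (_≡_; refl; sym; trans; cong; subst; setoid; module ≡-Reasoning)
open import Relation.Binary.Structures using (IsEquivalence)
open import Relation.Nullary using (¬_; yes; no; contradiction)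
open import Relation.Nullary.Decidable using (_×-dec_)
open import Relation.Unary using (Pred; Decidable)

-- Finite sets of nonnegative integers are presented by lists of their
-- elements; order and multiplicity are invisible to everything below.

FinSet : Set
FinSet = List ℕ

infixl 6 _⊕_

_⊕_ : FinSet → ℕ → FinSet
X ⊕ t = map (_+ t) X

residues : (i : ℕ) .{{_ : NonZero i}} → FinSet → Subset i
residues i X = ⋃ (map (λ a → ⁅ a mod i ⁆) X)

EqualMod : (i : ℕ) .{{_ : NonZero i}} → Rel FinSet 0ℓ
EqualMod i X Y = residues i X ≡ residues i Y

equalMod? : (i : ℕ) .{{_ : NonZero i}} → B.Decidable (EqualMod i)
equalMod? i X Y = ≡-dec _≟ᵇ_ (residues i X) (residues i Y)

elements : ∀ {i} → Subset i → FinSet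
elements {i} A = map toℕ (filter (_∈? A) (allFin i))

module _ {i : ℕ} .{{_ : NonZero i}} where

  private
    mod-cong : ∀ {a b} → a % i ≡ b % i → a mod i ≡ b mod i
    mod-cong {a} {b} eq = fromℕ<-cong (a % i) (b % i) eq (m%n<n a i) (m%n<n b i)

    mod-injective : ∀ {a b} → a mod i ≡ b mod i → a % i ≡ b % i
    mod-injective {a} {b} eq =
      trans (sym (toℕ-fromℕ< (m%n<n a i))) (trans (cong toℕ eq) (toℕ-fromℕ< (m%n<n b i)))

    %-congˡ : ∀ {a b} t → a % i ≡ b % i → (a + t) % i ≡ (b + t) % i
    %-congˡ {a} {b} t eq = begin
      (a + t) % i          ≡⟨ %-distribˡ-+ a t i ⟩
      (a % i + t % i) % i  ≡⟨ cong (λ z → (z + t % i) % i) eq ⟩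
      (b % i + t % i) % i  ≡⟨ %-distribˡ-+ b t i ⟨
      (b + t) % i          ∎
      where open ≡-Reasoning

  ∈-residues⁺ : ∀ {X a} → a ∈ˡ X → a mod i ∈ residues i X
  ∈-residues⁺ (here refl) = x∈p∪q⁺ (inj₁ (x∈⁅x⁆ _))
  ∈-residues⁺ (there a∈X) = x∈p∪q⁺ (inj₂ (∈-residues⁺ a∈X))

  ∈-residues⁻ : ∀ X {x} → x ∈ residues i X → ∃[ a ] a ∈ˡ X × x ≡ a mod i
  ∈-residues⁻ []      x∈ = contradiction x∈ ∉⊥
  ∈-residues⁻ (b ∷ X) x∈ with x∈p∪q⁻ ⁅ b mod i ⁆ (residues i X) x∈
  ... | inj₁ x∈b = b , here refl , x∈⁅y⁆⇒x≡y _ x∈b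
  ... | inj₂ x∈X with a , a∈X , eq ← ∈-residues⁻ X x∈X = a , there a∈X , eq

  ⊕-cong : ∀ X Y t → EqualMod i X Y → EqualMod i (X ⊕ t) (Y ⊕ t)
  ⊕-cong X Y t X≈Y = ⊆-antisym (half X Y X≈Y) (half Y X (sym X≈Y))
    where
    half : ∀ X Y → EqualMod i X Y → residues i (X ⊕ t) ⊆ residues i (Y ⊕ t)
    half X Y X≈Y x∈
      with _ , a+t∈ , refl ← ∈-residues⁻ (X ⊕ t) x∈
      with a , a∈X , refl ← ∈-map⁻ (_+ t) a+t∈
      with b , b∈Y , a≡b ← ∈-residues⁻ Y (subst (a mod i ∈_) X≈Y (∈-residues⁺ a∈X))
      = subst (_∈ residues i (Y ⊕ t))
          (mod-cong (%-congˡ t (sym (mod-injective a≡b))))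
          (∈-residues⁺ (∈-map⁺ (_+ t) b∈Y))

  residues-map-cong : ∀ {g h : ℕ → ℕ} → (∀ a → g a % i ≡ h a % i) →
                      ∀ X → EqualMod i (map g X) (map h X)
  residues-map-cong {g} {h} eq X = cong ⋃ (begin
    map (λ a → ⁅ a mod i ⁆) (map g X)  ≡⟨ map-∘ X ⟨
    map (λ a → ⁅ g a mod i ⁆) X        ≡⟨ map-cong (λ a → cong ⁅_⁆ (mod-cong (eq a))) X ⟩
    map (λ a → ⁅ h a mod i ⁆) X        ≡⟨ map-∘ X ⟩
    map (λ a → ⁅ a mod i ⁆) (map h X)  ∎)
    where open ≡-Reasoning

  ⊕-identityʳ : ∀ X → EqualMod i (X ⊕ 0) X
  ⊕-identityʳ X = trans (residues-map-cong (λ a → cong (_% i) (+-identityʳ a)) X)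
                        (cong (residues i) (map-id′ X))
    where
    map-id′ : ∀ (X : FinSet) → map (λ a → a) X ≡ X
    map-id′ []      = refl
    map-id′ (a ∷ X) = cong (a ∷_) (map-id′ X)

  ⊕-period : ∀ X → EqualMod i (X ⊕ i) X
  ⊕-period X = trans
    (residues-map-cong (λ a → trans ([m+n]%n≡m%n a i) (cong (_% i) (sym (+-identityʳ a)))) X)
    (⊕-identityʳ X)

  ⊕-% : ∀ X t → EqualMod i (X ⊕ (t % i)) (X ⊕ t)
  ⊕-% X t = residues-map-cong lemma X
    where
    open ≡-Reasoning
    lemma : ∀ a → (a + t % i) % i ≡ (a + t) % i
    lemma a = begin
      (a + t % i) % i          ≡⟨ %-distribˡ-+ a (t % i) i ⟩
      (a % i + t % i % i) % i  ≡⟨ cong (λ z → (a % i + z) % i) (m%n%n≡m%n t i) ⟩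
      (a % i + t % i) % i      ≡⟨ %-distribˡ-+ a t i ⟨
      (a + t) % i              ∎

  ⊕-assoc : ∀ X s t → X ⊕ s ⊕ t ≡ X ⊕ (s + t)
  ⊕-assoc X s t = trans (sym (map-∘ X)) (map-cong (λ a → +-assoc a s t) X)

IsLeast : Pred ℕ 0ℓ → Pred ℕ 0ℓ
IsLeast P l = P l × (∀ m → P m → l ≤ m)

least : ∀ {P : Pred ℕ 0ℓ} → Decidable P → ∀ n → P n → ∃ (IsLeast P)
least P? zero p = zero , p , λ _ _ → z≤n
least P? (suc n) p with P? zero
... | yes p₀ = zero , p₀ , λ _ _ → z≤n
... | no ¬p₀ with l , pl , l≤ ← least (P? ∘ suc) n p =
  suc l , pl , λ { zero p₀ → contradiction p₀ ¬p₀ ; (suc m) pm → s≤s (l≤ m pm) }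

module _ {i : ℕ} .{{_ : NonZero i}} where

  IsPeriod : Subset i → Pred ℕ 0ℓ
  IsPeriod A l = 1 ≤ l × EqualMod i (elements A) (elements A ⊕ l)

  isPeriod? : ∀ A → Decidable (IsPeriod A)
  isPeriod? A l = 1 ≤? l ×-dec equalMod? i (elements A) (elements A ⊕ l)

  leastPeriod : ∀ A → ∃ (IsLeast (IsPeriod A))
  leastPeriod A = least (isPeriod? A) i
    (>-nonZero⁻¹ i , sym (⊕-period (elements A)))

  f : Subset i → ℕ
  f A = proj₁ (leastPeriod A)

𝒜 : (s j i : ℕ) .{{_ : NonZero i}} → Pred (Subset i) 0ℓ
𝒜 s j i A = ∣ A ∣ ≡ j × f A ≡ s

𝒜? : ∀ s j i .{{_ : NonZero i}} → Decidable (𝒜 s j i)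
𝒜? s j i A = ∣ A ∣ ≟ j ×-dec f A ≟ s

KEquiv : (k : ℕ) .{{_ : NonZero k}} → Rel (Subset k) 0ℓ
KEquiv k A A′ = ∃[ j ] EqualMod k (elements A ⊕ toℕ {k} j) (elements A′)

kEquiv? : (k : ℕ) .{{_ : NonZero k}} → B.Decidable (KEquiv k)
kEquiv? k A A′ = any? (λ j → equalMod? k (elements A ⊕ toℕ j) (elements A′))

module _ {k : ℕ} .{{_ : NonZero k}} where

  private
    kEquiv : ∀ {A A′} t → EqualMod k (elements A ⊕ t) (elements A′) → KEquiv k A A′
    kEquiv {A} t eq = t mod k , trans (cong (λ z → residues k (elements A ⊕ z)) (toℕ-fromℕ< (m%n<n t k)))
                                      (trans (⊕-% (elements A) t) eq)

  kEquiv-isEquivalence : IsEquivalence (KEquiv k)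
  kEquiv-isEquivalence = record
    { refl  = λ {A} → kEquiv {A} {A} 0 (⊕-identityʳ (elements A))
    ; sym   = λ {A} {B} → λ { (j , eq) → kEquiv {B} {A} (k ∸ toℕ j) (begin
        residues k (elements B ⊕ (k ∸ toℕ j))           ≡⟨ ⊕-cong (elements A ⊕ toℕ j) (elements B) (k ∸ toℕ j) eq ⟨
        residues k (elements A ⊕ toℕ j ⊕ (k ∸ toℕ j))   ≡⟨ cong (residues k) (⊕-assoc (elements A) (toℕ j) (k ∸ toℕ j)) ⟩
        residues k (elements A ⊕ (toℕ j + (k ∸ toℕ j))) ≡⟨ cong (λ z → residues k (elements A ⊕ z)) (m+[n∸m]≡n (<⇒≤ (toℕ<n j))) ⟩
        residues k (elements A ⊕ k)                     ≡⟨ ⊕-period (elements A) ⟩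
        residues k (elements A)                         ∎) }
    ; trans = λ {A} {B} {C} → λ { (j , eq) (j′ , eq′) → kEquiv {A} {C} (toℕ j + toℕ j′) (begin
        residues k (elements A ⊕ (toℕ j + toℕ j′))  ≡⟨ cong (residues k) (⊕-assoc (elements A) (toℕ j) (toℕ j′)) ⟨
        residues k (elements A ⊕ toℕ j ⊕ toℕ j′)    ≡⟨ ⊕-cong (elements A ⊕ toℕ j) (elements B) (toℕ j′) eq ⟩
        residues k (elements B ⊕ toℕ j′)            ≡⟨ eq′ ⟩
        residues k (elements C)                     ∎) }
    }
    where open ≡-Reasoning

kEquivDecSetoid : (k : ℕ) .{{_ : NonZero k}} → DecSetoid 0ℓ 0ℓ
kEquivDecSetoid k = record
  { Carrier          = Subset k
  ; _≈_              = KEquiv k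
  ; isDecEquivalence = record { isEquivalence = kEquiv-isEquivalence ; _≟_ = kEquiv? k }
  }

-- A quotient set is a setoid here: the elements of 𝒫 n r k are the
-- members of 𝒜_n(r,k), two of them being equal when k-equivalent.

𝒫 : (n r k : ℕ) .{{_ : NonZero k}} → Setoid 0ℓ 0ℓ
𝒫 n r k = record
  { Carrier       = ∃ (𝒜 n r k)
  ; _≈_           = KEquiv k on proj₁
  ; isEquivalence = record { refl = E.refl ; sym = E.sym ; trans = E.trans }
  }
  where module E = IsEquivalence (kEquiv-isEquivalence {k})

subsets : ∀ i → List (Subset i)
subsets zero    = Vec.[] ∷ []
subsets (suc i) = map (outside Vec.∷_) (subsets i) ++ map (inside Vec.∷_) (subsets i)

∈-subsets : ∀ {i} (A : Subset i) → A ∈ˡ subsets i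
∈-subsets Vec.[]              = here refl
∈-subsets (outside Vec.∷ A)   = ∈-++⁺ˡ (∈-map⁺ _ (∈-subsets A))
∈-subsets {suc i} (inside Vec.∷ A) =
  ∈-++⁺ʳ (map (outside Vec.∷_) (subsets i)) (∈-map⁺ _ (∈-subsets A))

-- One member of each class of 𝒜_n(r,k); card𝒫-correct below shows that
-- card𝒫 n r k is the cardinality of the quotient.

representatives : (n r k : ℕ) .{{_ : NonZero k}} → List (Subset k)
representatives n r k = deduplicate (kEquiv? k) (filter (𝒜? n r k) (subsets k))

card𝒫 : (n r k : ℕ) .{{_ : NonZero k}} → ℕ
card𝒫 n r k = length (representatives n r k)

private
  lookup-injective : ∀ {a ℓ} {A : Set a} {R : Rel A ℓ} → B.Symmetric R → ∀ {xs} →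
                     AllPairs (λ x y → ¬ R x y) xs →
                     ∀ {p q} → R (lookup xs p) (lookup xs q) → p ≡ q
  lookup-injective R-sym (px ∷ pxs) {zero}  {zero}  r = refl
  lookup-injective R-sym (px ∷ pxs) {zero}  {suc q} r = contradiction r (All.lookup px (∈-lookup q))
  lookup-injective R-sym (px ∷ pxs) {suc p} {zero}  r = contradiction (R-sym r) (All.lookup px (∈-lookup p))
  lookup-injective R-sym (px ∷ pxs) {suc p} {suc q} r = cong suc (lookup-injective R-sym pxs r)

card𝒫-correct : ∀ n r k .{{_ : NonZero k}} → Bijection (setoid (Fin (card𝒫 n r k))) (𝒫 n r k)
card𝒫-correct n r k = record
  { to        = λ p → lookup reps p , All.lookup allReps (∈-lookup p)
  ; cong      = λ { refl → E.refl }
  ; bijective = lookup-injective E.sym (deduplicate-! (kEquivDecSetoid k) candidates)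
              , λ { (A , A∈𝒜) → let found = covered A A∈𝒜 in
                      Any.index found , λ { refl → E.sym (Anyₚ.lookup-index found) } }
  }
  where
  module E = IsEquivalence (kEquiv-isEquivalence {k})

  candidates reps : List (Subset k)
  candidates = filter (𝒜? n r k) (subsets k)
  reps       = representatives n r k

  allReps : All (𝒜 n r k) reps
  allReps = Allₚ.deduplicate⁺ (kEquiv? k) (Allₚ.all-filter (𝒜? n r k) (subsets k))

  covered : ∀ A → 𝒜 n r k A → Any (KEquiv k A) reps
  covered A A∈𝒜 = Anyₚ.deduplicate⁺ (kEquiv? k) (λ yRx A~x → E.trans A~x (E.sym yRx))
    (Any.map (λ { refl → E.refl }) (∈-filter⁺ (𝒜? n r k) (∈-subsets A) A∈𝒜))

S : (r k : ℕ) .{{_ : NonZero k}} → ℕ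
S r k = sum (map (λ n → card𝒫 (suc n) r k) (upTo k))

φ : ℕ → ℕ
φ n = length (filter (λ m → coprime? m n) (map suc (upTo n)))

-- Every divisor of d ≠ 0 is suc m for some m < d; for d = 0 this is the
-- empty sum.

∑∣ : ℕ → ((s : ℕ) .{{_ : NonZero s}} → ℕ) → ℕ
∑∣ d F = sum (map (λ m → F (suc m)) (filter (λ m → suc m ∣? d) (upTo d)))

-- The theorem is Burnside's lemma for the translations of ℤ/k acting on its
-- r-element subsets: k times the number of orbits is the number of pairs
-- (A , j), 1 ≤ j ≤ k, with A + j = A.  By Bézout such a j may be replaced by
-- d = gcd j k.  With k = s d, the sets fixed by d are s copies of a subset of
-- {0 , … , d - 1}, so C(k/s , r/s) of them have r elements if s ∣ r and none
-- otherwise, and exactly φ(s) of the j have gcd j k = k/s.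

module Submission where

open import Defs
open import Data.Integer.Base using (+_)
open import Data.Nat.Base using (ℕ; NonZero; _≤_; _*_; _/_)
open import Data.Nat.Combinatorics using (_C_)
open import Data.Nat.GCD using (gcd)
open import Data.Rational.Base using () renaming (_/_ to _/ℚ_; _*_ to _*ℚ_)
open import Relation.Binary.PropositionalEquality using (_≡_)

open import Algebra.Properties.CommutativeSemigroup using (interchange)
open import Data.Bool.Properties using () renaming (_≟_ to _≟ᵇ_)
open import Data.Fin.Base using (Fin; zero; suc; toℕ; fromℕ<; combine; remQuot)
open import Data.Fin.Properties using (toℕ<n; toℕ-fromℕ<; toℕ-injective; fromℕ<-cong; combine-remQuot; toℕ-combine)
open import Data.Fin.Subset using (Subset; inside; outside; ⁅_⁆; ∣_∣; _∪_; _⊆_) renaming (_∈_ to _∈ˢ_)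
open import Data.Fin.Subset.Properties using (⊆-antisym; ∣⊥∣≡0; ∣⁅x⁆∣≡1) renaming (_∈?_ to _∈ˢ?_)
open import Data.List.Base using (List; []; _∷_; map; filter; length; upTo; applyUpTo; _∷ʳ_; allFin; tabulate) renaming (_++_ to _++ˡ_)
open import Data.List.Membership.Propositional using (_∈_; lose)
open import Data.List.Membership.Propositional.Properties using (∈-map⁺; ∈-map⁻; ∈-upTo⁺; ∈-upTo⁻; ∈-filter⁺; ∈-filter⁻; ∈-allFin; ∈-lookup)
open import Data.List.Membership.Propositional.Properties.WithK using (unique∧set⇒bag)
open import Data.List.Properties using (map-∘; map-upTo; applyUpTo-∷ʳ; length-map; length-upTo; map-tabulate; map-++)
open import Data.List.Relation.Binary.BagAndSetEquality using (∼bag⇒↭)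
open import Data.List.Relation.Unary.All using (All; []; _∷_)
open import Data.List.Relation.Unary.AllPairs using (AllPairs; []; _∷_)
open import Data.List.Relation.Unary.Any using (Any; here; there)
open import Data.List.Relation.Unary.Unique.DecSetoid.Properties using (deduplicate-!)
open import Data.List.Relation.Unary.Unique.Propositional using (Unique)
open import Data.Nat.Base using (zero; suc; _+_; _∸_; pred; z≤n; s≤s; >-nonZero; >-nonZero⁻¹; _%_; ≢-nonZero; ≢-nonZero⁻¹)
open import Data.Nat.Combinatorics using (nCn≡1; nCk≡nC[n∸k]; nCk+nC[k+1]≡[n+1]C[k+1])
open import Data.Nat.Coprimality using (Coprime; coprime?; coprime⇒gcd≡1; gcd≡1⇒coprime)
open import Data.Nat.DivMod using (_mod_; m<n⇒m%n≡m; m%n<n; m%n%n≡m%n; %-distribˡ-+; %-remove-+ˡ; %-remove-+ʳ; m∣n⇒o%n%m≡o%m; m≡m%n+[m/n]*n; m*[n/m]≡n; m*n/n≡m)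
open import Data.Nat.Divisibility using (_∣_; _∣?_; divides; ∣-refl; ∣-trans; ∣⇒≤; m∣m*n; n∣m*n; ∣m+n∣m⇒∣n)
open import Data.Nat.GCD using (gcd-GCD; module Bézout; gcd[m,n]∣m; gcd[m,n]∣n; gcd-greatest; gcd[m,n]≢0; c*gcd[m,n]≡gcd[cm,cn])
open import Data.Nat.ListAction using (sum)
open import Data.Nat.ListAction.Properties using (sum-↭; sum-++)
open import Data.Nat.Properties
open import Data.Product.Base using (_×_; _,_; ∃-syntax; proj₁; proj₂)
open import Data.Rational.Base using (toℚᵘ)
open import Data.Rational.Properties using (toℚᵘ-injective; toℚᵘ-fromℚᵘ; toℚᵘ-homo-*)
open import Data.Rational.Unnormalised.Base using (mkℚᵘ; *≡*) renaming (_*_ to _*ᵘ_)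
open import Data.Rational.Unnormalised.Properties using (≃-setoid) renaming (*-cong to *ᵘ-cong)
open import Data.Sum.Base using (inj₁)
open import Data.Vec.Base using ([]; _∷_; here; there; _++_; concat; replicate; lookup) renaming (tabulate to tabulateᵛ)
open import Data.Vec.Properties using (≡-dec; ∷-injectiveʳ; ++-injectiveˡ; lookup-concat; lookup-replicate; lookup∘tabulate; lookup⇒[]=; []=⇒lookup)
open import Function.Base using (_∘_; id)
open import Function.Bundles using (mk⇔; Bijection)
open import Level using (0ℓ)
open import Relation.Binary.Core using (Rel)
open import Relation.Binary.Definitions using (DecidableEquality)
open import Relation.Binary.PropositionalEquality using (refl; sym; trans; cong; cong₂; subst; module ≡-Reasoning; subst₂)
open import Relation.Binary.Structures using (IsEquivalence)
open import Relation.Nullary using (Dec; yes; no; ¬_; contradiction)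
open import Relation.Unary using (Pred; Decidable)
import Data.List.Relation.Binary.Permutation.Propositional.Properties as Perm
import Data.List.Relation.Unary.All as All
import Data.List.Relation.Unary.Unique.Propositional.Properties as Unique
import Data.List.Relation.Unary.All.Properties as Allₚ
import Data.Integer.Base as ℤ
import Data.Integer.Properties as ℤ

-- The argument runs on the lists of representatives whose lengths are the `card𝒫 n r k`, so orbit
-- counting becomes an exchange of finite sums of indicators `𝟙`. It is carried out for each period
-- n separately: size and least period are invariant under translation, so every 𝒜_n(r,k) is stable
-- under the action. Since each set has exactly one least period and it lies between 1 and k, adding
-- over n merely drops the condition on the period. Subtraction is avoided throughout: the inverse
-- of translation by t is translation by `k ∸ t`, and the identity is proved in ℕ as a formula for
-- `k * S r k`, the rationals entering only at the end.

private
  variable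
    A B : Set
    P Q : Set

-- Finite sums and indicators

∑ : List A → (A → ℕ) → ℕ
∑ xs F = sum (map F xs)

syntax ∑ xs (λ x → e) = ∑[ x ← xs ] e

infix 5 ∑

𝟙 : Dec P → ℕ
𝟙 (yes _) = 1
𝟙 (no _)  = 0

𝟙-yes : (P? : Dec P) → P → 𝟙 P? ≡ 1
𝟙-yes (yes _) p = refl
𝟙-yes (no ¬p) p = contradiction p ¬p

𝟙-no : (P? : Dec P) → ¬ P → 𝟙 P? ≡ 0
𝟙-no (yes p) ¬p = contradiction p ¬p
𝟙-no (no _)  ¬p = refl

𝟙-cong : (P? : Dec P) (Q? : Dec Q) → (P → Q) → (Q → P) → 𝟙 P? ≡ 𝟙 Q?
𝟙-cong (yes p) Q? f g = sym (𝟙-yes Q? (f p))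
𝟙-cong (no ¬p) Q? f g = sym (𝟙-no Q? (¬p ∘ g))

∑-cong : ∀ (xs : List A) {F G : A → ℕ} → (∀ {x} → x ∈ xs → F x ≡ G x) → ∑ xs F ≡ ∑ xs G
∑-cong []       eq = refl
∑-cong (x ∷ xs) eq = cong₂ _+_ (eq (here refl)) (∑-cong xs (eq ∘ there))

∑-zero : ∀ (xs : List A) {F : A → ℕ} → (∀ {x} → x ∈ xs → F x ≡ 0) → ∑ xs F ≡ 0
∑-zero []       eq = refl
∑-zero (x ∷ xs) eq = cong₂ _+_ (eq (here refl)) (∑-zero xs (eq ∘ there))

∑-const : ∀ (xs : List A) c → ∑[ _ ← xs ] c ≡ length xs * c
∑-const []       c = refl
∑-const (x ∷ xs) c = cong (_+_ c) (∑-const xs c)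

∑-+ : ∀ (xs : List A) (F G : A → ℕ) → ∑[ x ← xs ] (F x + G x) ≡ ∑ xs F + ∑ xs G
∑-+ []       F G = refl
∑-+ (x ∷ xs) F G = trans (cong (_+_ (F x + G x)) (∑-+ xs F G))
  (interchange +-commutativeSemigroup (F x) (G x) (∑ xs F) (∑ xs G))

∑-swap : ∀ (xs : List A) (ys : List B) (F : A → B → ℕ) →
         ∑[ x ← xs ] ∑[ y ← ys ] F x y ≡ ∑[ y ← ys ] ∑[ x ← xs ] F x y
∑-swap []       ys F = sym (∑-zero ys (λ _ → refl))
∑-swap (x ∷ xs) ys F = trans (cong (_+_ (∑ ys (F x))) (∑-swap xs ys F))
  (sym (∑-+ ys (F x) (λ y → ∑[ x ← xs ] F x y)))

∑-*ˡ : ∀ (xs : List A) c (F : A → ℕ) → ∑[ x ← xs ] (c * F x) ≡ c * ∑ xs F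
∑-*ˡ []       c F = sym (*-zeroʳ c)
∑-*ˡ (x ∷ xs) c F = trans (cong (_+_ (c * F x)) (∑-*ˡ xs c F)) (sym (*-distribˡ-+ c (F x) (∑ xs F)))

∑-*ʳ : ∀ (xs : List A) c (F : A → ℕ) → ∑[ x ← xs ] (F x * c) ≡ ∑ xs F * c
∑-*ʳ xs c F = trans (∑-cong xs (λ {x} _ → *-comm (F x) c)) (trans (∑-*ˡ xs c F) (*-comm c (∑ xs F)))

∑-filter : ∀ {P : Pred A 0ℓ} (P? : Decidable P) xs (F : A → ℕ) →
           ∑ (filter P? xs) F ≡ ∑[ x ← xs ] (𝟙 (P? x) * F x)
∑-filter P? []       F = refl
∑-filter P? (x ∷ xs) F with P? x
... | yes _ = cong₂ _+_ (sym (+-identityʳ (F x))) (∑-filter P? xs F)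
... | no  _ = ∑-filter P? xs F

length-filter-𝟙 : ∀ {P : Pred A 0ℓ} (P? : Decidable P) xs →
                  length (filter P? xs) ≡ ∑[ x ← xs ] 𝟙 (P? x)
length-filter-𝟙 P? []       = refl
length-filter-𝟙 P? (x ∷ xs) with P? x
... | yes _ = cong suc (length-filter-𝟙 P? xs)
... | no  _ = length-filter-𝟙 P? xs

∑-map : ∀ (g : A → B) xs (F : B → ℕ) → ∑ (map g xs) F ≡ ∑ xs (F ∘ g)
∑-map g xs F = cong sum (sym (map-∘ xs))

-- Duplicate-free lists with the same members are permutations of each other, and a sum does not see
-- the order.
∑-reindex : ∀ {xs : List A} {ys : List B} (g : A → B) (F : B → ℕ) →
            Unique xs → Unique ys → (∀ {x y} → g x ≡ g y → x ≡ y) →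
            (∀ {x} → x ∈ xs → g x ∈ ys) → (∀ {y} → y ∈ ys → ∃[ x ] x ∈ xs × y ≡ g x) →
            ∑ ys F ≡ ∑ xs (F ∘ g)
∑-reindex {xs = xs} {ys} g F xs! ys! inj into onto = trans
  (sum-↭ (Perm.map⁺ F (∼bag⇒↭ (unique∧set⇒bag ys! (Unique.map⁺ inj xs!)
    (mk⇔ (λ y∈ → let x , x∈ , eq = onto y∈ in subst (_∈ map g xs) (sym eq) (∈-map⁺ g x∈))
         (λ y∈ → let x , x∈ , eq = ∈-map⁻ g y∈ in subst (_∈ ys) (sym eq) (into x∈)))))))
  (∑-map g xs F)

-- The relation `R` is arbitrary so that the lemma serves both duplicate-free lists, with `R`
-- equality, and lists of pairwise inequivalent representatives, with `R` the k-equivalence.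
∑-single : ∀ {R : Rel A 0ℓ} {P : Pred A 0ℓ} (P? : Decidable P) {F : A → ℕ} {c} xs →
           AllPairs (λ x y → ¬ R x y) xs → (∀ {x y} → P x → P y → R x y) →
           (∀ {x} → P x → F x ≡ c) → (∀ {x} → ¬ P x → F x ≡ 0) → Any P xs → ∑ xs F ≡ c
∑-single P? (x ∷ xs) (x≁ ∷ _) same on off (here px) =
  trans (cong₂ _+_ (on px) (∑-zero xs λ y∈ → off λ py → All.lookup x≁ y∈ (same px py))) (+-identityʳ _)
∑-single P? (x ∷ xs) (x≁ ∷ xs≁) same on off (there p) with P? x
... | yes px = ∑-single P? (x ∷ xs) (x≁ ∷ xs≁) same on off (here px)
... | no ¬px = cong₂ _+_ (off ¬px) (∑-single P? xs xs≁ same on off p)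

-- Both sides are the sum of `F` over 0, ..., n, with one end point split off.
∑-upTo-suc : ∀ n (F : ℕ → ℕ) → ∑ (upTo n) (F ∘ suc) + F 0 ≡ ∑ (upTo n) F + F n
∑-upTo-suc n F = trans (+-comm _ (F 0)) (begin
  F 0 + ∑ (upTo n) (F ∘ suc)          ≡⟨ cong (λ xs → F 0 + sum xs) (map-upTo (F ∘ suc) n) ⟩
  sum (applyUpTo F (suc n))           ≡⟨ cong sum (applyUpTo-∷ʳ F n) ⟨
  sum (applyUpTo F n ∷ʳ F n)          ≡⟨ sum-++ (applyUpTo F n) (F n ∷ []) ⟩
  sum (applyUpTo F n) + (F n + 0)     ≡⟨ cong₂ _+_ (cong sum (sym (map-upTo F n))) (+-identityʳ (F n)) ⟩
  ∑ (upTo n) F + F n                  ∎)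
  where open ≡-Reasoning

∑-periodic-suc : ∀ n (F : ℕ → ℕ) → F n ≡ F 0 → ∑ (upTo n) (F ∘ suc) ≡ ∑ (upTo n) F
∑-periodic-suc n F eq = +-cancelʳ-≡ (F 0) _ _ (trans (∑-upTo-suc n F) (cong (_+_ (∑ (upTo n) F)) eq))

∑-periodic : ∀ n (F : ℕ → ℕ) → (∀ j → F (n + j) ≡ F j) → ∀ t → ∑[ j ← upTo n ] F (t + j) ≡ ∑ (upTo n) F
∑-periodic n F eq zero    = refl
∑-periodic n F eq (suc t) = trans
  -- The induction on `t` is for all `F` at once: one step of the shift is absorbed into `F ∘ suc`,
  -- which is again periodic.
  (∑-periodic n (F ∘ suc) (λ j → trans (cong F (sym (+-suc n j))) (eq (suc j))) t)
  (∑-periodic-suc n F (trans (cong F (sym (+-identityʳ n))) (eq 0)))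

-- Subsets and their sizes

subsets-unique : ∀ n → Unique (subsets n)
subsets-unique zero    = [] ∷ []
subsets-unique (suc n) = Unique.++⁺
  (Unique.map⁺ ∷-injectiveʳ (subsets-unique n)) (Unique.map⁺ ∷-injectiveʳ (subsets-unique n))
  λ (p , q) → outside≢inside (∈-map⁻ (outside ∷_) p) (∈-map⁻ (inside ∷_) q)
  where
  outside≢inside : ∀ {v} → (∃[ B ] B ∈ subsets n × v ≡ outside ∷ B) →
                   ¬ (∃[ B ] B ∈ subsets n × v ≡ inside ∷ B)
  outside≢inside (_ , _ , refl) (_ , _ , ())

_≟ˢ_ : ∀ {n} → DecidableEquality (Subset n)
_≟ˢ_ = ≡-dec _≟ᵇ_

-- Only an inequality, since distinct entries may share a residue. It is enough for translates:
-- translating back yields the reverse bound.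
∣residues∣≤length : ∀ k .{{_ : NonZero k}} X → ∣ residues k X ∣ ≤ length X
∣residues∣≤length k []      = ≤-reflexive (∣⊥∣≡0 k)
∣residues∣≤length k (a ∷ X) = ≤-trans (∣p∪q∣≤∣p∣+∣q∣ ⁅ a mod k ⁆ (residues k X))
  (+-mono-≤ (≤-reflexive (∣⁅x⁆∣≡1 (a mod k))) (∣residues∣≤length k X))
  where
  ∣p∪q∣≤∣p∣+∣q∣ : ∀ {n} (p q : Subset n) → ∣ p ∪ q ∣ ≤ ∣ p ∣ + ∣ q ∣
  ∣p∪q∣≤∣p∣+∣q∣ []            []            = z≤n
  ∣p∪q∣≤∣p∣+∣q∣ (outside ∷ p) (outside ∷ q) = ∣p∪q∣≤∣p∣+∣q∣ p q
  ∣p∪q∣≤∣p∣+∣q∣ (outside ∷ p) (inside ∷ q)  =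
    ≤-trans (s≤s (∣p∪q∣≤∣p∣+∣q∣ p q)) (≤-reflexive (sym (+-suc ∣ p ∣ ∣ q ∣)))
  ∣p∪q∣≤∣p∣+∣q∣ (inside ∷ p)  (outside ∷ q) = s≤s (∣p∪q∣≤∣p∣+∣q∣ p q)
  ∣p∪q∣≤∣p∣+∣q∣ (inside ∷ p)  (inside ∷ q)  =
    s≤s (≤-trans (∣p∪q∣≤∣p∣+∣q∣ p q) (+-monoʳ-≤ ∣ p ∣ (n≤1+n ∣ q ∣)))

length-elements : ∀ {n} (A : Subset n) → length (elements A) ≡ ∣ A ∣
length-elements {n} A = begin
  length (elements A)                            ≡⟨ length-map toℕ (filter (_∈ˢ? A) (allFin n)) ⟩
  length (filter (_∈ˢ? A) (allFin n))            ≡⟨ length-filter-𝟙 (_∈ˢ? A) (allFin n) ⟩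
  ∑[ x ← allFin n ] 𝟙 (x ∈ˢ? A)                  ≡⟨ ∑-∈? A ⟩
  ∣ A ∣                                          ∎
  where
  open ≡-Reasoning
  ∑-∈?-suc : ∀ {n} s (A : Subset n) → ∑[ x ← tabulate suc ] 𝟙 (x ∈ˢ? (s ∷ A)) ≡ ∑[ x ← allFin n ] 𝟙 (x ∈ˢ? A)
  ∑-∈?-suc {n} s A = trans (cong (λ xs → ∑[ x ← xs ] 𝟙 (x ∈ˢ? (s ∷ A))) (sym (map-tabulate id suc)))
    (trans (∑-map suc (allFin n) _)
      (∑-cong (allFin n) λ {x} _ → 𝟙-cong (suc x ∈ˢ? (s ∷ A)) (x ∈ˢ? A) (λ { (there p) → p }) there))

  ∑-∈? : ∀ {n} (A : Subset n) → ∑[ x ← allFin n ] 𝟙 (x ∈ˢ? A) ≡ ∣ A ∣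
  ∑-∈? []            = refl
  ∑-∈? (outside ∷ A) = trans (∑-∈?-suc outside A) (∑-∈? A)
  ∑-∈? (inside ∷ A)  = cong suc (trans (∑-∈?-suc inside A) (∑-∈? A))

-- Translations of subsets modulo k

module _ {k : ℕ} .{{_ : NonZero k}} where

  -- The action of ℤ/k by translation. Taking residues at once turns equality modulo k into
  -- propositional equality of subsets.
  shift : Subset k → ℕ → Subset k
  shift A t = residues k (elements A ⊕ t)

  toℕ-mod : ∀ (x : Fin k) → toℕ x mod k ≡ x
  toℕ-mod x = toℕ-injective (trans (toℕ-fromℕ< _) (m<n⇒m%n≡m (toℕ<n x)))

  ∈-elements⁺ : ∀ {A : Subset k} {x} → x ∈ˢ A → toℕ x ∈ elements A
  ∈-elements⁺ x∈A = ∈-map⁺ toℕ (∈-filter⁺ (_∈ˢ? _) (∈-allFin _) x∈A)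

  ∈-elements⁻ : ∀ {A : Subset k} {a} → a ∈ elements A → ∃[ x ] x ∈ˢ A × a ≡ toℕ x
  ∈-elements⁻ a∈ with x , x∈ , refl ← ∈-map⁻ toℕ a∈ = x , proj₂ (∈-filter⁻ (_∈ˢ? _) {xs = allFin k} x∈) , refl

  residues-elements : ∀ (A : Subset k) → residues k (elements A) ≡ A
  residues-elements A = ⊆-antisym
    (λ x∈ → let a , a∈ , x≡a = ∈-residues⁻ (elements A) x∈
                y , y∈ , a≡y = ∈-elements⁻ {A} a∈
            in subst (_∈ˢ A) (sym (trans x≡a (trans (cong (_mod k) a≡y) (toℕ-mod y)))) y∈)
    (λ {x} x∈ → subst (_∈ˢ residues k (elements A)) (toℕ-mod x) (∈-residues⁺ (∈-elements⁺ {A} x∈)))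

  ∈-shift⁺ : ∀ (A : Subset k) t {x} → x ∈ˢ A → (toℕ x + t) mod k ∈ˢ shift A t
  ∈-shift⁺ A t x∈ = ∈-residues⁺ (∈-map⁺ (_+ t) (∈-elements⁺ {A} x∈))

  ∈-shift⁻ : ∀ (A : Subset k) t {y} → y ∈ˢ shift A t → ∃[ x ] x ∈ˢ A × y ≡ (toℕ x + t) mod k
  ∈-shift⁻ A t y∈
    with _ , b∈ , refl ← ∈-residues⁻ (elements A ⊕ t) y∈
    with _ , a∈ , refl ← ∈-map⁻ (_+ t) b∈
    with x , x∈ , refl ← ∈-elements⁻ {A} a∈ = x , x∈ , refl

  shift-0 : ∀ A → shift A 0 ≡ A
  shift-0 A = trans (⊕-identityʳ (elements A)) (residues-elements A)

  shift-+ : ∀ A s t → shift (shift A s) t ≡ shift A (s + t)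
  shift-+ A s t = trans
    -- The list of elements of a translate is only equal modulo k to the translated list, so the
    -- second translation must respect `EqualMod`.
    (⊕-cong (elements (shift A s)) (elements A ⊕ s) t (residues-elements (shift A s)))
    (cong (residues k) (⊕-assoc (elements A) s t))

  shift-k : ∀ A → shift A k ≡ A
  shift-k A = trans (⊕-period (elements A)) (residues-elements A)

  shift-k+ : ∀ A t → shift A (k + t) ≡ shift A t
  shift-k+ A t = trans (sym (shift-+ A k t)) (cong (λ B → shift B t) (shift-k A))

  shift-∸ : ∀ A {t} → t ≤ k → shift (shift A t) (k ∸ t) ≡ A
  shift-∸ A {t} t≤k = trans (shift-+ A t (k ∸ t)) (trans (cong (shift A) (m+[n∸m]≡n t≤k)) (shift-k A))

  shift-comm : ∀ A s t → shift (shift A s) t ≡ shift (shift A t) s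
  shift-comm A s t = trans (shift-+ A s t) (trans (cong (shift A) (+-comm s t)) (sym (shift-+ A t s)))

  ∣shift∣≤ : ∀ A t → ∣ shift A t ∣ ≤ ∣ A ∣
  ∣shift∣≤ A t = ≤-trans (∣residues∣≤length k (elements A ⊕ t))
    (≤-reflexive (trans (length-map (_+ t) (elements A)) (length-elements A)))

  ∣shift∣ : ∀ A {t} → t ≤ k → ∣ shift A t ∣ ≡ ∣ A ∣
  ∣shift∣ A {t} t≤k = ≤-antisym (∣shift∣≤ A t)
    (subst (λ B → ∣ B ∣ ≤ ∣ shift A t ∣) (shift-∸ A t≤k) (∣shift∣≤ (shift A t) (k ∸ t)))

  f-least : ∀ A {l} → 1 ≤ l → shift A l ≡ A → f A ≤ l
  f-least A {l} 1≤l eq = proj₂ (proj₂ (leastPeriod A)) l (1≤l , trans (residues-elements A) (sym eq))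

  1≤f : ∀ A → 1 ≤ f A
  1≤f A = proj₁ (proj₁ (proj₂ (leastPeriod A)))

  shift-f : ∀ A → shift A (f A) ≡ A
  shift-f A = trans (sym (proj₂ (proj₁ (proj₂ (leastPeriod A))))) (residues-elements A)

  f≤k : ∀ A → f A ≤ k
  f≤k A = f-least A (>-nonZero⁻¹ k) (shift-k A)

  -- Translations commute, so every period of `A` is a period of its translates.
  f-shift≤ : ∀ A t → f (shift A t) ≤ f A
  f-shift≤ A t = f-least (shift A t) (1≤f A) (trans (shift-comm A t (f A)) (cong (λ B → shift B t) (shift-f A)))

  f-shift : ∀ A {t} → t ≤ k → f (shift A t) ≡ f A
  f-shift A {t} t≤k = ≤-antisym (f-shift≤ A t)
    (subst (λ B → f B ≤ f (shift A t)) (shift-∸ A t≤k) (f-shift≤ (shift A t) (k ∸ t)))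

  𝒜-shift : ∀ {n r A t} → t ≤ k → 𝒜 n r k A → 𝒜 n r k (shift A t)
  𝒜-shift {A = A} t≤k (size , period) = trans (∣shift∣ A t≤k) size , trans (f-shift A t≤k) period

  -- Transporters and orbit counting

  transporters : Subset k → Subset k → ℕ
  transporters A B = ∑[ j ← upTo k ] 𝟙 (shift A j ≟ˢ B)

  -- Each of the k translations carries `A` to exactly one set, which again lies in 𝒜_n(r,k).
  ∑-transporters : ∀ n r {A} → 𝒜 n r k A → ∑ (filter (𝒜? n r k) (subsets k)) (transporters A) ≡ k
  ∑-transporters n r {A} A∈ = begin
    ∑[ B ← candidates ] ∑[ j ← upTo k ] 𝟙 (shift A j ≟ˢ B)  ≡⟨ ∑-swap candidates (upTo k) _ ⟩
    ∑[ j ← upTo k ] ∑[ B ← candidates ] 𝟙 (shift A j ≟ˢ B)  ≡⟨ ∑-cong (upTo k) (λ j∈ → one (<⇒≤ (∈-upTo⁻ j∈))) ⟩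
    ∑[ _ ← upTo k ] 1                                       ≡⟨ ∑-const (upTo k) 1 ⟩
    length (upTo k) * 1                                     ≡⟨ *-identityʳ _ ⟩
    length (upTo k)                                         ≡⟨ length-upTo k ⟩
    k                                                       ∎
    where
    open ≡-Reasoning
    candidates : List (Subset k)
    candidates = filter (𝒜? n r k) (subsets k)
    one : ∀ {j} → j ≤ k → ∑[ B ← candidates ] 𝟙 (shift A j ≟ˢ B) ≡ 1
    one {j} j≤k = ∑-single (shift A j ≟ˢ_) candidates (Unique.filter⁺ (𝒜? n r k) (subsets-unique k))
      (λ p q → trans (sym p) q) (𝟙-yes (_ ≟ˢ _)) (𝟙-no (_ ≟ˢ _))
      (∈-filter⁺ (𝒜? n r k) (∈-subsets (shift A j)) (𝒜-shift j≤k A∈))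

  -- The translations from `A` to `B` form a coset of the stabiliser of `B`: if A + t = B, then j
  -- fixes `B` exactly when t + j carries `A` to `B`, and by periodicity the window t, ..., t + k -
  -- 1 counts the same as 0, ..., k - 1.
  transporters-orbit : ∀ A B → KEquiv k A B → transporters A B ≡ transporters B B
  transporters-orbit A B (t , eq) = sym (trans
    (∑-cong (upTo k) λ {j} _ → cong (λ X → 𝟙 (X ≟ˢ B))
      (trans (cong (λ X → shift X j) (sym A+t≡B)) (shift-+ A (toℕ t) j)))
    (∑-periodic k (λ j → 𝟙 (shift A j ≟ˢ B)) (λ j → cong (λ X → 𝟙 (X ≟ˢ B)) (shift-k+ A j)) (toℕ t)))
    where
    A+t≡B : shift A (toℕ t) ≡ B
    A+t≡B = trans eq (residues-elements B)

  transporters-¬orbit : ∀ A B → ¬ KEquiv k A B → transporters A B ≡ 0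
  transporters-¬orbit A B A≁B = ∑-zero (upTo k) λ j∈ → 𝟙-no (_ ≟ˢ _)
    λ eq → let j<k = ∈-upTo⁻ j∈ in
      A≁B (fromℕ< j<k , trans (cong (shift A) (toℕ-fromℕ< j<k)) (trans eq (sym (residues-elements B))))

  -- Orbit counting: summing the transporters from R to A over all A gives k,
  -- while summing them over the class representatives R leaves the
  -- stabiliser of A.
  card𝒫-stabilisers : ∀ n r → card𝒫 n r k * k ≡ ∑[ A ← filter (𝒜? n r k) (subsets k) ] transporters A A
  card𝒫-stabilisers n r = begin
    length reps * k                                      ≡⟨ ∑-const reps k ⟨
    ∑[ R ← reps ] k                                      ≡⟨ ∑-cong reps (λ R∈ → sym (∑-transporters n r (All.lookup allReps R∈))) ⟩
    ∑[ R ← reps ] ∑[ A ← candidates ] transporters R A   ≡⟨ ∑-swap reps candidates transporters ⟩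
    ∑[ A ← candidates ] ∑[ R ← reps ] transporters R A   ≡⟨ ∑-cong candidates (λ A∈ → stabiliser (proj₂ (∈-filter⁻ (𝒜? n r k) {xs = subsets k} A∈))) ⟩
    ∑[ A ← candidates ] transporters A A                 ∎
    where
    open ≡-Reasoning
    module E = IsEquivalence (kEquiv-isEquivalence {k})
    open Bijection (card𝒫-correct n r k) using (strictlySurjective)
    candidates reps : List (Subset k)
    candidates = filter (𝒜? n r k) (subsets k)
    reps       = representatives n r k
    allReps : All (𝒜 n r k) reps
    allReps = Allₚ.deduplicate⁺ (kEquiv? k) (Allₚ.all-filter (𝒜? n r k) (subsets k))
    stabiliser : ∀ {A} → 𝒜 n r k A → ∑[ R ← reps ] transporters R A ≡ transporters A A
    stabiliser {A} A∈ = ∑-single (λ R → kEquiv? k R A) reps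
      (deduplicate-! (kEquivDecSetoid k) candidates)
      (λ p q → E.trans p (E.sym q)) (transporters-orbit _ A) (transporters-¬orbit _ A)
      (let p , p~A = strictlySurjective (A , A∈) in lose (∈-lookup p) p~A)

  S-stabilisers : ∀ r → k * S r k ≡ ∑[ A ← subsets k ] (𝟙 (∣ A ∣ ≟ r) * transporters A A)
  S-stabilisers r = begin
    k * S r k
      ≡⟨ *-comm k (S r k) ⟩
    S r k * k
      ≡⟨ ∑-*ʳ (upTo k) k (λ n → card𝒫 (suc n) r k) ⟨
    ∑[ n ← upTo k ] (card𝒫 (suc n) r k * k)
      ≡⟨ ∑-cong (upTo k) (λ {n} _ → trans (card𝒫-stabilisers (suc n) r) (∑-filter (𝒜? (suc n) r k) (subsets k) _)) ⟩
    ∑[ n ← upTo k ] ∑[ A ← subsets k ] (𝟙 (𝒜? (suc n) r k A) * transporters A A)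
      ≡⟨ ∑-swap (upTo k) (subsets k) _ ⟩
    ∑[ A ← subsets k ] ∑[ n ← upTo k ] (𝟙 (𝒜? (suc n) r k A) * transporters A A)
      ≡⟨ ∑-cong (subsets k) (λ {A} _ → trans (∑-*ʳ (upTo k) (transporters A A) _) (cong (_* transporters A A) (byPeriod A))) ⟩
    ∑[ A ← subsets k ] (𝟙 (∣ A ∣ ≟ r) * transporters A A)
      ∎
    where
    open ≡-Reasoning
    byPeriod : ∀ A → ∑[ n ← upTo k ] 𝟙 (𝒜? (suc n) r k A) ≡ 𝟙 (∣ A ∣ ≟ r)
    byPeriod A = match (∣ A ∣ ≟ r)
      where
      match : ∀ (size? : Dec (∣ A ∣ ≡ r)) → ∑[ n ← upTo k ] 𝟙 (𝒜? (suc n) r k A) ≡ 𝟙 size?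
      match (no ≢r)  = ∑-zero (upTo k) λ {n} _ → 𝟙-no (𝒜? (suc n) r k A) (≢r ∘ proj₁)
      match (yes ≡r) = ∑-single (λ n → f A ≟ suc n) (upTo k) (Unique.upTo⁺ k)
        (λ p q → suc-injective (trans (sym p) q))
        (λ {n} p → 𝟙-yes (𝒜? (suc n) r k A) (≡r , p))
        (λ {n} ¬p → 𝟙-no (𝒜? (suc n) r k A) (¬p ∘ proj₂))
        -- The index n stands for the period `suc n`, so the witness is the predecessor of `f A`,
        -- which exists because periods are positive.
        (lose (∈-upTo⁺ (subst (_≤ k) f≡ (f≤k A))) f≡)
        where
        f≡ : f A ≡ suc (pred (f A))
        f≡ = sym (suc-pred (f A) {{>-nonZero (1≤f A)}})

  -- Fixed sets and reduction to divisors of k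

  shift-* : ∀ A t → shift A t ≡ A → ∀ m → shift A (m * t) ≡ A
  shift-* A t eq zero    = shift-0 A
  shift-* A t eq (suc m) = trans (sym (shift-+ A t (m * t))) (trans (cong (λ X → shift X (m * t)) eq) (shift-* A t eq m))

  -- Replaces a translation by -t. Bézout's identity over ℕ has a sum on one side, gcd + y k = x j
  -- or gcd + x j = y k, and this removes the summand that already fixes `A`.
  shift-cancelʳ : ∀ A s t → shift A (s + t) ≡ A → shift A t ≡ A → shift A s ≡ A
  shift-cancelʳ A s t s+t-fixes t-fixes = begin
    shift A s            ≡⟨ cong (λ X → shift X s) t-fixes ⟨
    shift (shift A t) s  ≡⟨ shift-comm A t s ⟩
    shift (shift A s) t  ≡⟨ shift-+ A s t ⟩
    shift A (s + t)      ≡⟨ s+t-fixes ⟩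
    A                    ∎
    where open ≡-Reasoning

  shift-gcd⁺ : ∀ A j → shift A j ≡ A → shift A (gcd j k) ≡ A
  shift-gcd⁺ A j eq with Bézout.identity (gcd-GCD j k)
  ... | Bézout.+- x y e = shift-cancelʳ A _ (y * k)
    (trans (cong (shift A) e) (shift-* A j eq x)) (shift-* A k (shift-k A) y)
  ... | Bézout.-+ x y e = shift-cancelʳ A _ (x * j)
    (trans (cong (shift A) e) (shift-* A k (shift-k A) y)) (shift-* A j eq x)

  shift-gcd⁻ : ∀ A j → shift A (gcd j k) ≡ A → shift A j ≡ A
  shift-gcd⁻ A j eq with divides q j≡q*g ← gcd[m,n]∣m j k = trans (cong (shift A) j≡q*g) (shift-* A (gcd j k) eq q)

  mod-cong : ∀ {a b} → a % k ≡ b % k → a mod k ≡ b mod k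
  mod-cong eq = fromℕ<-cong _ _ eq _ _

  toℕ-mod-% : ∀ a → toℕ (a mod k) ≡ a % k
  toℕ-mod-% a = toℕ-fromℕ< (m%n<n a k)

  [m%k+n]%k : ∀ m n → (m % k + n) % k ≡ (m + n) % k
  [m%k+n]%k m n = begin
    (m % k + n) % k          ≡⟨ %-distribˡ-+ (m % k) n k ⟩
    (m % k % k + n % k) % k  ≡⟨ cong (λ z → (z + n % k) % k) (m%n%n≡m%n m k) ⟩
    (m % k + n % k) % k      ≡⟨ %-distribˡ-+ m n k ⟨
    (m + n) % k              ∎
    where open ≡-Reasoning

  ∈-shift-fixed : ∀ A t a → shift A t ≡ A → a mod k ∈ˢ A → (a + t) mod k ∈ˢ A
  ∈-shift-fixed A t a eq a∈ = subst₂ _∈ˢ_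
    (mod-cong (trans (cong (λ z → (z + t) % k) (toℕ-mod-% a)) ([m%k+n]%k a t))) eq (∈-shift⁺ A t a∈)

  fixed : ℕ → ℕ → ℕ
  fixed r j = ∑[ A ← subsets k ] (𝟙 (∣ A ∣ ≟ r) * 𝟙 (shift A j ≟ˢ A))

  fixed-gcd : ∀ r j → fixed r j ≡ fixed r (gcd j k)
  fixed-gcd r j = ∑-cong (subsets k) λ {A} _ →
    cong (𝟙 (∣ A ∣ ≟ r) *_) (𝟙-cong (_ ≟ˢ _) (_ ≟ˢ _) (shift-gcd⁺ A j) (shift-gcd⁻ A j))

  S-burnside : ∀ r → k * S r k ≡ ∑[ j ← upTo k ] fixed r (gcd (suc j) k)
  S-burnside r = begin
    k * S r k
      ≡⟨ S-stabilisers r ⟩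
    ∑[ A ← subsets k ] (𝟙 (∣ A ∣ ≟ r) * transporters A A)
      ≡⟨ ∑-cong (subsets k) (λ {A} _ → ∑-*ˡ (upTo k) (𝟙 (∣ A ∣ ≟ r)) (λ j → 𝟙 (shift A j ≟ˢ A))) ⟨
    ∑[ A ← subsets k ] ∑[ j ← upTo k ] (𝟙 (∣ A ∣ ≟ r) * 𝟙 (shift A j ≟ˢ A))
      ≡⟨ ∑-swap (subsets k) (upTo k) _ ⟩
    ∑[ j ← upTo k ] fixed r j
      -- Translations by 0 and by k agree, so j may run over 1, ..., k, the kind of range over which
      -- `φ` counts.
      ≡⟨ ∑-periodic-suc k (fixed r) fixed-k ⟨
    ∑[ j ← upTo k ] fixed r (suc j)
      ≡⟨ ∑-cong (upTo k) (λ {j} _ → fixed-gcd r (suc j)) ⟩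
    ∑[ j ← upTo k ] fixed r (gcd (suc j) k)
      ∎
    where
    open ≡-Reasoning
    fixed-k : fixed r k ≡ fixed r 0
    fixed-k = ∑-cong (subsets k) λ {A} _ →
      cong (λ X → 𝟙 (∣ A ∣ ≟ r) * 𝟙 (X ≟ˢ A)) (trans (shift-k A) (sym (shift-0 A)))

-- Periodic sets as repeated blocks

repeat : ∀ s {d} → Subset d → Subset (s * d)
repeat s B = concat (replicate s B)

∣repeat∣ : ∀ s {d} (B : Subset d) → ∣ repeat s B ∣ ≡ s * ∣ B ∣
∣repeat∣ zero    B = refl
∣repeat∣ (suc s) B = trans (∣++∣ B (repeat s B)) (cong (_+_ ∣ B ∣) (∣repeat∣ s B))
  where
  ∣++∣ : ∀ {m n} (p : Subset m) (q : Subset n) → ∣ p ++ q ∣ ≡ ∣ p ∣ + ∣ q ∣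
  ∣++∣ []            q = refl
  ∣++∣ (outside ∷ p) q = ∣++∣ p q
  ∣++∣ (inside ∷ p)  q = cong suc (∣++∣ p q)

repeat-injective : ∀ s .{{_ : NonZero s}} {d} {B B′ : Subset d} → repeat s B ≡ repeat s B′ → B ≡ B′
repeat-injective (suc s) eq = ++-injectiveˡ _ _ eq

module _ (s d : ℕ) .{{_ : NonZero s}} .{{_ : NonZero d}} .{{_ : NonZero (s * d)}} where

  -- Position j of block i sits at d i + j in the concatenation, and this is j modulo d.
  lookup-repeat : ∀ (B : Subset d) x → lookup (repeat s B) x ≡ lookup B (toℕ x mod d)
  lookup-repeat B x = begin
    lookup (repeat s B) x                            ≡⟨ cong (lookup (repeat s B)) (combine-remQuot {s} d x) ⟨
    lookup (repeat s B) (combine i j)                ≡⟨ lookup-concat (replicate s B) i j ⟩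
    lookup (lookup (replicate s B) i) j              ≡⟨ cong (λ v → lookup v j) (lookup-replicate i B) ⟩
    lookup B j                                       ≡⟨ cong (lookup B) j≡ ⟩
    lookup B (toℕ x mod d)                           ∎
    where
    open ≡-Reasoning
    i = proj₁ (remQuot {s} d x)
    j = proj₂ (remQuot {s} d x)
    j≡ : j ≡ toℕ x mod d
    j≡ = toℕ-injective (sym (begin
      toℕ (toℕ x mod d)          ≡⟨ toℕ-mod-% (toℕ x) ⟩
      toℕ x % d                  ≡⟨ cong (λ y → toℕ y % d) (combine-remQuot {s} d x) ⟨
      toℕ (combine i j) % d      ≡⟨ cong (_% d) (toℕ-combine i j) ⟩
      (d * toℕ i + toℕ j) % d    ≡⟨ %-remove-+ˡ (toℕ j) (m∣m*n (toℕ i)) ⟩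
      toℕ j % d                  ≡⟨ m<n⇒m%n≡m (toℕ<n j) ⟩
      toℕ j                      ∎))

  ∈-repeat⁺ : ∀ (B : Subset d) {x} → toℕ x mod d ∈ˢ B → x ∈ˢ repeat s B
  ∈-repeat⁺ B {x} p = lookup⇒[]= x _ (trans (lookup-repeat B x) ([]=⇒lookup p))

  ∈-repeat⁻ : ∀ (B : Subset d) {x} → x ∈ˢ repeat s B → toℕ x mod d ∈ˢ B
  ∈-repeat⁻ B {x} p = lookup⇒[]= _ B (trans (sym (lookup-repeat B x)) ([]=⇒lookup p))

  -- Every multiple of `d` is allowed, because the opposite inclusion for `d` itself goes through
  -- the inverse translation, by `s * d ∸ d`.
  shift-repeat⊆ : ∀ (B : Subset d) t → d ∣ t → shift (repeat s B) t ⊆ repeat s B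
  shift-repeat⊆ B t d∣t y∈ with x , x∈ , refl ← ∈-shift⁻ (repeat s B) t y∈ =
    ∈-repeat⁺ B (subst (_∈ˢ B) (mod-cong (sym residue)) (∈-repeat⁻ B x∈))
    where
    open ≡-Reasoning
    residue : toℕ ((toℕ x + t) mod (s * d)) % d ≡ toℕ x % d
    residue = begin
      toℕ ((toℕ x + t) mod (s * d)) % d  ≡⟨ cong (_% d) (toℕ-mod-% (toℕ x + t)) ⟩
      (toℕ x + t) % (s * d) % d          ≡⟨ m∣n⇒o%n%m≡o%m d (s * d) (toℕ x + t) (n∣m*n s) ⟩
      (toℕ x + t) % d                    ≡⟨ %-remove-+ʳ (toℕ x) d∣t ⟩
      toℕ x % d                          ∎

  shift-repeat : ∀ (B : Subset d) → shift (repeat s B) d ≡ repeat s B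
  -- For the reverse inclusion, y is translated back by `s * d ∸ d`; the resulting point still lies
  -- in `repeat s B`, and moving it by `d` returns y.
  shift-repeat B = ⊆-antisym (shift-repeat⊆ B d ∣-refl) λ {y} y∈ →
    let x , x∈ , y≡ = ∈-shift⁻ (shift (repeat s B) (s * d ∸ d)) d
                        (subst (y ∈ˢ_) (sym (trans (shift-comm _ (s * d ∸ d) d) (shift-∸ _ (m≤n*m d s)))) y∈)
    in subst (_∈ˢ shift (repeat s B) d) (sym y≡)
         (∈-shift⁺ (repeat s B) d (shift-repeat⊆ B (s * d ∸ d) d∣s*d∸d x∈))
    where
    d∣s*d∸d : d ∣ s * d ∸ d
    d∣s*d∸d = ∣m+n∣m⇒∣n (subst (d ∣_) (sym (m+[n∸m]≡n (m≤n*m d s))) (n∣m*n s)) ∣-refl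

  -- The block is the trace of `A` on 0, ..., d - 1. It determines `A`, since x and x % d differ by
  -- a multiple of `d` and so belong to `A` together.
  shift-fixed⇒repeat : ∀ A → shift A d ≡ A → ∃[ B ] A ≡ repeat s B
  shift-fixed⇒repeat A eq = block , ⊆-antisym
    (λ {x} x∈ → ∈-repeat⁺ block (∈-block⁺ (reduce (toℕ x) (subst (_∈ˢ A) (sym (toℕ-mod x)) x∈))))
    -- Going up from x % d to x takes x / d translations by `d`.
    (λ {x} x∈ → subst (_∈ˢ A) (trans (cong (_mod (s * d)) (sym (m≡m%n+[m/n]*n (toℕ x) d))) (toℕ-mod x))
      (∈-shift-fixed A (toℕ x / d * d) (toℕ x % d) (shift-* A d eq (toℕ x / d)) (∈-block⁻ (∈-repeat⁻ block x∈))))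
    where
    block : Subset d
    block = tabulateᵛ λ j → lookup A (toℕ j mod (s * d))

    block-residue : ∀ a → lookup block (a mod d) ≡ lookup A ((a % d) mod (s * d))
    block-residue a = trans (lookup∘tabulate _ (a mod d)) (cong (λ z → lookup A (z mod (s * d))) (toℕ-mod-% a))

    ∈-block⁺ : ∀ {a} → (a % d) mod (s * d) ∈ˢ A → a mod d ∈ˢ block
    ∈-block⁺ {a} p = lookup⇒[]= _ block (trans (block-residue a) ([]=⇒lookup p))

    ∈-block⁻ : ∀ {a} → a mod d ∈ˢ block → (a % d) mod (s * d) ∈ˢ A
    ∈-block⁻ {a} p = lookup⇒[]= _ A (trans (sym (block-residue a)) ([]=⇒lookup p))

    -- Adding (s ∸ 1) * (a / d) further multiples of d to a turns the
    -- quotient part (a / d) * d into a multiple of s * d.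
    reduce : ∀ a → a mod (s * d) ∈ˢ A → (a % d) mod (s * d) ∈ˢ A
    reduce a a∈ = subst (_∈ˢ A) (mod-cong (begin
      (a + pred s * q * d) % (s * d)              ≡⟨ cong (λ z → (z + pred s * q * d) % (s * d)) (m≡m%n+[m/n]*n a d) ⟩
      (a % d + q * d + pred s * q * d) % (s * d)  ≡⟨ cong (_% (s * d)) (+-assoc (a % d) (q * d) _) ⟩
      (a % d + (q * d + pred s * q * d)) % (s * d) ≡⟨ %-remove-+ʳ (a % d) (divides q multiple) ⟩
      (a % d) % (s * d)                           ∎))
      (∈-shift-fixed A (pred s * q * d) a (shift-* A d eq (pred s * q)) a∈)
      where
      open ≡-Reasoning
      q = a / d
      multiple : q * d + pred s * q * d ≡ q * (s * d)
      multiple = begin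
        q * d + pred s * q * d   ≡⟨ *-distribʳ-+ d q (pred s * q) ⟨
        (suc (pred s) * q) * d   ≡⟨ cong (λ z → (z * q) * d) (suc-pred s) ⟩
        (s * q) * d              ≡⟨ cong (_* d) (*-comm s q) ⟩
        (q * s) * d              ≡⟨ *-assoc q s d ⟩
        q * (s * d)              ∎

-- Binomial coefficients and Euler's totient as counts

∑-subsets-suc : ∀ n (F : Subset (suc n) → ℕ) →
  ∑ (subsets (suc n)) F ≡ ∑ (subsets n) (F ∘ (outside ∷_)) + ∑ (subsets n) (F ∘ (inside ∷_))
∑-subsets-suc n F = begin
  ∑ (map (outside ∷_) (subsets n) ++ˡ map (inside ∷_) (subsets n)) F
    ≡⟨ cong sum (map-++ F (map (outside ∷_) (subsets n)) _) ⟩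
  sum (map F (map (outside ∷_) (subsets n)) ++ˡ map F (map (inside ∷_) (subsets n)))
    ≡⟨ sum-++ (map F (map (outside ∷_) (subsets n))) _ ⟩
  ∑ (map (outside ∷_) (subsets n)) F + ∑ (map (inside ∷_) (subsets n)) F
    ≡⟨ cong₂ _+_ (∑-map (outside ∷_) (subsets n) F) (∑-map (inside ∷_) (subsets n) F) ⟩
  ∑ (subsets n) (F ∘ (outside ∷_)) + ∑ (subsets n) (F ∘ (inside ∷_))
    ∎
  where open ≡-Reasoning

-- Splitting the subsets by whether they contain the least element 0 is Pascal's rule.
∑-subsets-ofSize : ∀ n m → ∑[ B ← subsets n ] 𝟙 (∣ B ∣ ≟ m) ≡ n C m
∑-subsets-ofSize zero zero       = refl
∑-subsets-ofSize zero (suc m)    = refl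
∑-subsets-ofSize (suc n) zero    = trans (∑-subsets-suc n (λ B → 𝟙 (∣ B ∣ ≟ 0)))
  (trans (cong₂ _+_ (∑-subsets-ofSize n 0) (∑-zero (subsets n) (λ {B} _ → 𝟙-no (suc ∣ B ∣ ≟ 0) λ ())))
         (trans (+-identityʳ (n C 0)) (trans (nC0≡1 n) (sym (nC0≡1 (suc n))))))
  where
  nC0≡1 : ∀ n → n C 0 ≡ 1
  nC0≡1 n = trans (nCk≡nC[n∸k] {0} {n} z≤n) (nCn≡1 n)
∑-subsets-ofSize (suc n) (suc m) = begin
  ∑[ B ← subsets (suc n) ] 𝟙 (∣ B ∣ ≟ suc m)
    ≡⟨ ∑-subsets-suc n (λ B → 𝟙 (∣ B ∣ ≟ suc m)) ⟩
  (∑[ B ← subsets n ] 𝟙 (∣ B ∣ ≟ suc m)) + (∑[ B ← subsets n ] 𝟙 (suc ∣ B ∣ ≟ suc m))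
    ≡⟨ cong₂ _+_ (∑-subsets-ofSize n (suc m)) (trans
         (∑-cong (subsets n) λ {B} _ → 𝟙-cong (suc ∣ B ∣ ≟ suc m) (∣ B ∣ ≟ m) suc-injective (cong suc))
         (∑-subsets-ofSize n m)) ⟩
  n C suc m + n C m
    ≡⟨ +-comm (n C suc m) (n C m) ⟩
  n C m + n C suc m
    ≡⟨ nCk+nC[k+1]≡[n+1]C[k+1] n m ⟩
  suc n C suc m
    ∎
  where open ≡-Reasoning

-- The factorisation is a hypothesis on a variable `k`, so that matching it with `refl` turns
-- `Subset k` into `Subset (s * d)`, the type of `repeat s B`.
fixed-divisor : ∀ {k} .{{_ : NonZero k}} r s d .{{_ : NonZero s}} .{{_ : NonZero d}} → k ≡ s * d →
                fixed {k} r d ≡ 𝟙 (s ∣? r) * (d C (r / s))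
fixed-divisor r s d refl = begin
  ∑[ A ← subsets (s * d) ] (𝟙 (∣ A ∣ ≟ r) * 𝟙 (shift A d ≟ˢ A))
    ≡⟨ ∑-cong (subsets (s * d)) (λ {A} _ → *-comm (𝟙 (∣ A ∣ ≟ r)) _) ⟩
  ∑[ A ← subsets (s * d) ] (𝟙 (shift A d ≟ˢ A) * 𝟙 (∣ A ∣ ≟ r))
    ≡⟨ ∑-filter fixed? (subsets (s * d)) (λ A → 𝟙 (∣ A ∣ ≟ r)) ⟨
  ∑[ A ← filter fixed? (subsets (s * d)) ] 𝟙 (∣ A ∣ ≟ r)
    ≡⟨ ∑-reindex (repeat s) (λ A → 𝟙 (∣ A ∣ ≟ r)) (subsets-unique d) (Unique.filter⁺ fixed? (subsets-unique (s * d)))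
         (repeat-injective s) (λ {B} _ → ∈-filter⁺ fixed? (∈-subsets (repeat s B)) (shift-repeat s d B))
         (λ {A} A∈ → let B , A≡ = shift-fixed⇒repeat s d A (proj₂ (∈-filter⁻ fixed? {xs = subsets (s * d)} A∈))
                     in B , ∈-subsets B , A≡) ⟩
  ∑[ B ← subsets d ] 𝟙 (∣ repeat s B ∣ ≟ r)
    ≡⟨ ∑-cong (subsets d) (λ {B} _ → cong (λ z → 𝟙 (z ≟ r)) (∣repeat∣ s B)) ⟩
  ∑[ B ← subsets d ] 𝟙 (s * ∣ B ∣ ≟ r)
    ≡⟨ ofSize (s ∣? r) ⟩
  𝟙 (s ∣? r) * (d C (r / s))
    ∎
  where
  open ≡-Reasoning
  fixed? : Decidable (λ (A : Subset (s * d)) → shift A d ≡ A)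
  fixed? A = shift A d ≟ˢ A
  ofSize : ∀ (s∣r? : Dec (s ∣ r)) → ∑[ B ← subsets d ] 𝟙 (s * ∣ B ∣ ≟ r) ≡ 𝟙 s∣r? * (d C (r / s))
  ofSize (no s∤r)  = ∑-zero (subsets d) λ {B} _ → 𝟙-no (s * ∣ B ∣ ≟ r) λ eq → s∤r (subst (s ∣_) eq (m∣m*n ∣ B ∣))
  ofSize (yes s∣r) = trans
    (∑-cong (subsets d) λ {B} _ → 𝟙-cong (s * ∣ B ∣ ≟ r) (∣ B ∣ ≟ r / s)
      (λ eq → *-cancelˡ-≡ _ _ s (trans eq (sym (m*[n/m]≡n s∣r))))
      (λ eq → trans (cong (s *_) eq) (m*[n/m]≡n s∣r)))
    (trans (∑-subsets-ofSize d (r / s)) (sym (+-identityʳ _)))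

-- Multiplication by `d` maps the i in 1, ..., s coprime to `s` bijectively onto the j in 1, ..., s
-- d with gcd j (s d) = d; the latter condition appears multiplied by `s`.
φ-count : ∀ {k} s d .{{_ : NonZero s}} .{{_ : NonZero d}} → k ≡ s * d →
          ∑[ j ← upTo k ] 𝟙 (s * gcd (suc j) k ≟ k) ≡ φ s
φ-count s d refl = begin
  ∑[ j ← upTo (s * d) ] 𝟙 (gcd? (suc j))             ≡⟨ ∑-map suc (upTo (s * d)) (𝟙 ∘ gcd?) ⟨
  ∑[ j ← map suc (upTo (s * d)) ] 𝟙 (gcd? j)         ≡⟨ length-filter-𝟙 gcd? (map suc (upTo (s * d))) ⟨
  length js                                          ≡⟨ length-∑ js ⟩
  ∑[ _ ← js ] 1                                      ≡⟨ ∑-reindex (_* d) (λ _ → 1) (unique s (λ i → coprime? i s)) (unique (s * d) gcd?) (*-cancelʳ-≡ _ _ d) into onto ⟩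
  ∑[ _ ← is ] 1                                      ≡⟨ length-∑ is ⟨
  length is                                          ∎
  where
  open ≡-Reasoning
  gcd? : Decidable (λ j → s * gcd j (s * d) ≡ s * d)
  gcd? j = s * gcd j (s * d) ≟ s * d
  is js : List ℕ
  is = filter (λ i → coprime? i s) (map suc (upTo s))
  js = filter gcd? (map suc (upTo (s * d)))

  length-∑ : ∀ (xs : List ℕ) → length xs ≡ ∑[ _ ← xs ] 1
  length-∑ xs = sym (trans (∑-const xs 1) (*-identityʳ _))

  unique : ∀ n {P : Pred ℕ 0ℓ} (P? : Decidable P) → Unique (filter P? (map suc (upTo n)))
  unique n P? = Unique.filter⁺ P? (Unique.map⁺ suc-injective (Unique.upTo⁺ n))

  ∈-range⁺ : ∀ {i n} → 1 ≤ i → i ≤ n → i ∈ map suc (upTo n)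
  ∈-range⁺ {suc i} _ i<n = ∈-map⁺ suc (∈-upTo⁺ i<n)

  ∈-range⁻ : ∀ {i n} → i ∈ map suc (upTo n) → 1 ≤ i × i ≤ n
  ∈-range⁻ i∈ with _ , j∈ , refl ← ∈-map⁻ suc i∈ = s≤s z≤n , ∈-upTo⁻ j∈

  gcd-*ʳ : ∀ i → gcd (i * d) (s * d) ≡ gcd i s * d
  gcd-*ʳ i = trans (cong₂ gcd (*-comm i d) (*-comm s d)) (trans (sym (c*gcd[m,n]≡gcd[cm,cn] d i s)) (*-comm d _))

  into : ∀ {i} → i ∈ is → i * d ∈ js
  into {i} i∈ with i∈range , i⊥s ← ∈-filter⁻ (λ i → coprime? i s) {xs = map suc (upTo s)} i∈
              with 1≤i , i≤s ← ∈-range⁻ i∈range =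
    ∈-filter⁺ gcd? (∈-range⁺ (*-mono-≤ 1≤i (>-nonZero⁻¹ d)) (*-monoˡ-≤ d i≤s))
      (cong (s *_) (trans (gcd-*ʳ i) (trans (cong (_* d) (coprime⇒gcd≡1 i⊥s)) (*-identityˡ d))))

  onto : ∀ {j} → j ∈ js → ∃[ i ] i ∈ is × j ≡ i * d
  onto {j} j∈ with j∈range , eq ← ∈-filter⁻ gcd? {xs = map suc (upTo (s * d))} j∈
              with 1≤j , j≤ ← ∈-range⁻ j∈range
              with gcd≡d ← *-cancelˡ-≡ _ _ s eq
              with divides i refl ← subst (_∣ j) gcd≡d (gcd[m,n]∣m j (s * d)) =
    i , ∈-filter⁺ (λ i → coprime? i s) (∈-range⁺ (1≤ i 1≤j) (*-cancelʳ-≤ i s d j≤)) coprime , refl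
    where
    1≤ : ∀ i → 1 ≤ i * d → 1 ≤ i
    1≤ (suc i) _ = s≤s z≤n
    coprime : Coprime i s
    coprime = gcd≡1⇒coprime (*-cancelʳ-≡ _ 1 d (trans (sym (gcd-*ʳ i)) (trans gcd≡d (sym (*-identityˡ d)))))

-- The divisor sum

k*S≡∑ : ∀ k r .{{_ : NonZero k}} → k * S r k ≡ ∑∣ (gcd k r) (λ s → ((k / s) C (r / s)) * φ s)
k*S≡∑ k r = begin
  k * S r k
    ≡⟨ S-burnside r ⟩
  ∑[ j ← upTo k ] fixed r (g j)
    -- The j are grouped by s = k / gcd j k: exactly one `suc m` is this cofactor, so a sum of
    -- indicators equal to 1 can be inserted.
    ≡⟨ ∑-cong (upTo k) (λ {j} _ → trans (∑-*ʳ (upTo k) (fixed r (g j)) _)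
         (trans (cong (_* fixed r (g j)) (cofactor j)) (*-identityˡ _))) ⟨
  ∑[ j ← upTo k ] ∑[ m ← upTo k ] (𝟙 (suc m * g j ≟ k) * fixed r (g j))
    ≡⟨ ∑-swap (upTo k) (upTo k) _ ⟩
  ∑[ m ← upTo k ] ∑[ j ← upTo k ] (𝟙 (suc m * g j ≟ k) * fixed r (g j))
    ≡⟨ ∑-cong (upTo k) (λ {m} _ → trans (∑-cong (upTo k) (λ {j} _ → evaluate m j (suc m * g j ≟ k)))
         (trans (∑-*ʳ (upTo k) _ _) (term m (suc m ∣? k) (suc m ∣? r)))) ⟩
  ∑[ m ← upTo k ] (𝟙 (∣gcd? m) * weight m)
    ≡⟨ ∑-filter ∣gcd? (upTo k) weight ⟨
  ∑ (filter ∣gcd? (upTo k)) weight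
    -- The two ranges contain the same divisors: a divisor of the gcd is at most the gcd, which is
    -- at most k.
    ≡⟨ ∑-reindex id weight (unique (gcd k r)) (unique k) id
         (λ m∈ → let m< , m∣ = ∈-filter⁻ ∣gcd? {xs = upTo (gcd k r)} m∈
                 in ∈-filter⁺ ∣gcd? (∈-upTo⁺ (≤-trans (∈-upTo⁻ m<) (∣⇒≤ (gcd[m,n]∣m k r)))) m∣)
         (λ {m} m∈ → let _ , m∣ = ∈-filter⁻ ∣gcd? {xs = upTo k} m∈
                     in m , ∈-filter⁺ ∣gcd? (∈-upTo⁺ (∣⇒≤ {{gcd-nonZero}} m∣)) m∣ , refl) ⟩
  ∑∣ (gcd k r) (λ s → ((k / s) C (r / s)) * φ s)
    ∎
  where
  open ≡-Reasoning
  g : ℕ → ℕ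
  g j = gcd (suc j) k

  gcd-nonZero : NonZero (gcd k r)
  gcd-nonZero = ≢-nonZero (gcd[m,n]≢0 k r (inj₁ (≢-nonZero⁻¹ k)))

  ∣gcd? : Decidable (λ m → suc m ∣ gcd k r)
  ∣gcd? m = suc m ∣? gcd k r

  weight : ℕ → ℕ
  weight m = ((k / suc m) C (r / suc m)) * φ (suc m)

  unique : ∀ n → Unique (filter ∣gcd? (upTo n))
  unique n = Unique.filter⁺ ∣gcd? (Unique.upTo⁺ n)

  cofactor : ∀ j → ∑[ m ← upTo k ] 𝟙 (suc m * g j ≟ k) ≡ 1
  cofactor j = ∑-single (λ m → suc m * g j ≟ k) (upTo k) (Unique.upTo⁺ k)
    (λ p q → suc-injective (*-cancelʳ-≡ _ _ (g j) {{g-nonZero}} (trans p (sym q))))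
    (𝟙-yes (_ ≟ k)) (𝟙-no (_ ≟ k)) (witness (gcd[m,n]∣n (suc j) k))
    where
    g-nonZero : NonZero (g j)
    g-nonZero = ≢-nonZero (gcd[m,n]≢0 (suc j) k (inj₁ λ ()))
    witness : g j ∣ k → Any (λ m → suc m * g j ≡ k) (upTo k)
    witness (divides zero eq)    = contradiction eq (≢-nonZero⁻¹ k)
    witness (divides (suc q) eq) = lose (∈-upTo⁺ (∣⇒≤ (divides (g j) (trans eq (*-comm (suc q) (g j)))))) (sym eq)

  -- Where the indicator is nonzero, `g j` is `k / suc m`; the fixed-set count then no longer
  -- depends on j and leaves the sum over j.
  evaluate : ∀ m j (d : Dec (suc m * g j ≡ k)) →
             𝟙 d * fixed r (g j) ≡ 𝟙 d * (𝟙 (suc m ∣? r) * ((k / suc m) C (r / suc m)))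
  evaluate m j (no _)   = refl
  evaluate m j (yes eq) = cong (1 *_) (trans
    (fixed-divisor r (suc m) (g j) {{_}} {{≢-nonZero (gcd[m,n]≢0 (suc j) k (inj₁ λ ()))}} (sym eq))
    (cong (λ z → 𝟙 (suc m ∣? r) * (z C (r / suc m))) g≡))
    where
    g≡ : g j ≡ k / suc m
    g≡ = trans (sym (m*n/n≡m (g j) (suc m))) (cong (_/ suc m) (trans (*-comm (g j) (suc m)) eq))

  -- With s = `suc m`: if s does not divide r the second factor vanishes, and if s does not divide k
  -- no j satisfies s * g j = k. Otherwise s divides the gcd and the sum over j is `φ s`.
  term : ∀ m (∣k? : Dec (suc m ∣ k)) (∣r? : Dec (suc m ∣ r)) →
         (∑[ j ← upTo k ] 𝟙 (suc m * g j ≟ k)) * (𝟙 ∣r? * ((k / suc m) C (r / suc m)))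
         ≡ 𝟙 (∣gcd? m) * weight m
  term m ∣k? (no s∤r) = trans (*-zeroʳ (∑[ j ← upTo k ] 𝟙 (suc m * g j ≟ k)))
    (cong (_* weight m) (sym (𝟙-no (∣gcd? m) λ s∣gcd → s∤r (∣-trans s∣gcd (gcd[m,n]∣n k r)))))
  term m (no s∤k) (yes _) = trans
    (cong (_* (1 * ((k / suc m) C (r / suc m)))) (∑-zero (upTo k) λ {j} _ → 𝟙-no (suc m * g j ≟ k) λ eq → s∤k (subst (suc m ∣_) eq (m∣m*n (g j)))))
    (cong (_* weight m) (sym (𝟙-no (∣gcd? m) λ s∣gcd → s∤k (∣-trans s∣gcd (gcd[m,n]∣m k r)))))
  term m (yes s∣k) (yes s∣r) = begin
    (∑[ j ← upTo k ] 𝟙 (suc m * g j ≟ k)) * (1 * c)  ≡⟨ cong₂ _*_ (φ-count (suc m) (k / suc m) {{_}} {{k/s-nonZero}} k≡) (*-identityˡ c) ⟩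
    φ (suc m) * c                                    ≡⟨ *-comm (φ (suc m)) c ⟩
    c * φ (suc m)                                    ≡⟨ *-identityˡ _ ⟨
    1 * (c * φ (suc m))                              ≡⟨ cong (_* weight m) (𝟙-yes (∣gcd? m) (gcd-greatest s∣k s∣r)) ⟨
    𝟙 (∣gcd? m) * (c * φ (suc m))                    ∎
    where
    c = (k / suc m) C (r / suc m)
    k≡ : k ≡ suc m * (k / suc m)
    k≡ = sym (m*[n/m]≡n s∣k)
    k/s-nonZero : NonZero (k / suc m)
    k/s-nonZero = ≢-nonZero λ eq → ≢-nonZero⁻¹ k (trans k≡ (trans (cong (suc m *_) eq) (*-zeroʳ (suc m))))

-- Passage to the rationals

/ℚ-cancel : ∀ k .{{_ : NonZero k}} {m n} → k * m ≡ n → (+ m) /ℚ 1 ≡ ((+ 1) /ℚ k) *ℚ ((+ n) /ℚ 1)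
-- `_/ℚ_` reduces its fraction to lowest terms, so the equation is checked on unnormalised
-- fractions, where it is a cross multiplication. `mkℚᵘ` takes the denominator minus one, hence
-- `k-1`.
/ℚ-cancel k@(suc k-1) {m} {n} eq = toℚᵘ-injective (begin
  toℚᵘ ((+ m) /ℚ 1)                            ≈⟨ toℚᵘ-fromℚᵘ (mkℚᵘ (+ m) 0) ⟩
  mkℚᵘ (+ m) 0                                 ≈⟨ *≡* cross ⟩
  mkℚᵘ (+ 1) k-1 *ᵘ mkℚᵘ (+ n) 0               ≈⟨ *ᵘ-cong (toℚᵘ-fromℚᵘ (mkℚᵘ (+ 1) k-1)) (toℚᵘ-fromℚᵘ (mkℚᵘ (+ n) 0)) ⟨
  toℚᵘ ((+ 1) /ℚ k) *ᵘ toℚᵘ ((+ n) /ℚ 1)       ≈⟨ toℚᵘ-homo-* ((+ 1) /ℚ k) ((+ n) /ℚ 1) ⟨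
  toℚᵘ (((+ 1) /ℚ k) *ℚ ((+ n) /ℚ 1))          ∎)
  where
  open import Relation.Binary.Reasoning.Setoid ≃-setoid
  cross : + m ℤ.* (+ (k * 1)) ≡ (+ 1 ℤ.* + n) ℤ.* + 1
  cross = trans (sym (ℤ.pos-* m (k * 1))) (trans (cong +_ crossℕ)
    (trans (ℤ.pos-* (1 * n) 1) (cong (ℤ._* + 1) (ℤ.pos-* 1 n))))
    where
    crossℕ : m * (k * 1) ≡ 1 * n * 1
    crossℕ = trans (cong (m *_) (*-identityʳ k)) (trans (*-comm m k)
      (trans eq (sym (trans (*-identityʳ _) (*-identityˡ n)))))

theorem2 : ∀ (k r : ℕ) .{{_ : NonZero k}} → 2 ≤ k → 1 ≤ r → r ≤ k →
    (+ S r k) /ℚ 1 ≡ ((+ 1) /ℚ k) *ℚ ((+ ∑∣ (gcd k r) (λ s → ((k / s) C (r / s)) * φ s)) /ℚ 1)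
theorem2 k r _ _ _ = /ℚ-cancel k (k*S≡∑ k r)
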